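{- Let $\vec{K}$ be a complete symmetric digraph on a finite or infinite (not necessarily countable) vertex set, let $r\ge 0$ be an integer, and let $\ell_1,\dots,\ell_r$ be positive integers. Let $c\colon E(\vec{K})\to\{1,\dots,r+1\}$ be an edge-colouring of $\vec{K}$ such that for every $i\in\{1,\dots,r\}$ there is no directed path of length $\ell_i$ all of whose edges have colour $i$. Then $V(\vec{K})$ can be partitioned into $\prod_{i=1}^{r}\ell_i$ (possibly empty) sets, each of which induces a complete symmetric digraph that is monochromatic in colour $r+1$; that is, for each set $U$ of the partition, every edge $(x,y)$ with $x,y\in U$, $x\ne y$, has colour $r+1$.
   Context: The complete symmetric digraph on a vertex set $V$ has as edges all ordered pairs $(x,y)$ of distinct elements of $V$ (so $(x,y)$ and $(y,x)$ are different edges and may receive different colours). A directed path of length $\ell$ is a sequence of $\ell+1$ distinct vertices $v_0v_1\dots v_\ell$ together with the $\ell$ edges $(v_0,v_1),\dots,(v_{\ell-1},v_\ell)$; its length is its number of edges. The empty product equals $1$. -}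

module Defs where

open import Data.Fin using (Fin; suc; inject₁)
open import Data.Fin.Properties using (suc-injective)
open import Data.Nat using (ℕ; suc)
open import Data.Product using (_×_)
open import Function using (_∘_)
open import Function.Definitions using (Injective)
open import Level using (Level)
open import Relation.Binary.PropositionalEquality using (_≡_; _≢_)
open import Relation.Unary using (Pred; _∈_; _⊥_; ⋃; Universal)

private variable
  a p : Level
  r n : ℕ

-- The distinctness proof is irrelevant, so an edge is determined by its
-- endpoints and a colouring cannot depend on that proof.
record Edge (V : Set a) : Set a where
  constructor edge
  field
    source target : V
    .distinct     : source ≢ target

open Edge public using (source; target)

inject₁≢suc : (i : Fin n) → inject₁ i ≢ suc i
inject₁≢suc (suc i) = inject₁≢suc i ∘ suc-injective

-- The length is the number of edges.
record DirectedPath (V : Set a) (length : ℕ) : Set a where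
  field
    vertex    : Fin (suc length) → V
    injective : Injective _≡_ _≡_ vertex

  pathEdge : Fin length → Edge V
  pathEdge i = edge (vertex (inject₁ i)) (vertex (suc i)) (inject₁≢suc i ∘ injective)

-- The colours 1, …, r + 1 are encoded as Fin (suc r): colour i ≤ r is
-- inject₁ of an element of Fin r, and colour r + 1 is fromℕ r.
Colouring : Set a → ℕ → Set a
Colouring V r = Edge V → Fin (suc r)

MonochromaticPath : {V : Set a} {length : ℕ} →
                    Colouring V r → Fin (suc r) → DirectedPath V length → Set
MonochromaticPath c k P = ∀ i → c (DirectedPath.pathEdge P i) ≡ k

MonochromaticOn : {V : Set a} → Colouring V r → Fin (suc r) → Pred V p → Set _
MonochromaticOn c k U = ∀ e → source e ∈ U → target e ∈ U → c e ≡ k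

-- Parts may be empty.
IsPartition : {V : Set a} {n : ℕ} → (Fin n → Pred V p) → Set _
IsPartition {n = n} U = Universal (⋃ (Fin n) U) × (∀ i j → i ≢ j → U i ⊥ U j)

{-# OPTIONS --safe #-}

-- For each colour i ≤ r the edges of colour i form a digraph with no path of
-- length ℓ i, so by the Gallai–Roy theorem V has a colouring with ℓ i values
-- that separates the endpoints of each such edge.  The parts are the classes of
-- the product of these r vertex colourings.
--
-- Gallai–Roy: let M be a maximal acyclic subdigraph of R, and give v a number k
-- such that M has a walk with k but none with k + 1 edges starting at v.  Walks
-- of M are paths, hence k < ℓ.  The numbers decrease strictly along walks of M,
-- and by maximality the endpoints of every edge of R are joined by such a walk
-- in one direction or the other.

module Submission where

open import Defs
open import Axiom.ExcludedMiddle using (ExcludedMiddle)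
open import Axiom.Extensionality.Propositional using (Extensionality; lower-extensionality)
open import Data.Bool using (Bool; true; false; T)
open import Data.Bool.Properties using (T?)
open import Data.Empty using (⊥-elim)
open import Data.Empty.Irrelevant using () renaming (⊥-elim to ⊥-elim-irr)
open import Data.Fin using (Fin; zero; suc; inject₁; fromℕ; fromℕ<; combine)
open import Data.Fin.Properties using (combine-injective; fromℕ<-injective)
open import Data.Fin.Relation.Unary.Top using (view; ‵fromℕ; ‵inj₁)
open import Data.List using (tabulate)
open import Data.Nat using (ℕ; zero; suc; _<_)
open import Data.Nat.ListAction using (product)
open import Data.Nat.Properties using (m<n⇒m<1+n; n<1+n)
open import Data.Product using (_×_; _,_; proj₁; proj₂; ∃-syntax; Σ-syntax)
open import Data.Sum using (_⊎_; inj₁; inj₂; swap; [_,_]′)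
open import Data.Unit using (tt)
open import Data.Unit.Polymorphic using (⊤)
open import Function using (_∘_)
open import Level using (Level; Lift; lift; 0ℓ)
open import Relation.Binary using (Rel; Irreflexive)
open import Relation.Binary.Construct.Closure.Transitive using (TransClosure; [_]; _∷_; _++_)
open import Relation.Binary.PropositionalEquality using (_≡_; _≢_; refl; sym; trans; cong; subst)
open import Relation.Nullary using (¬_; Dec; yes; no; contradiction)
open import Relation.Nullary.Decidable using (⌊_⌋; toWitness; fromWitness; decidable-stable)
open import Relation.Unary using (Pred)

private variable
  a : Level

-- Subsets and inclusion.

-- Subsets are Boolean-valued so that a family of subsets of E : Set a is again
-- in Set a, where excluded middle is available.
Subset : Set a → Set a
Subset E = E → Bool

infix 4 _⊆_

_⊆_ : {E : Set a} → Subset E → Subset E → Set a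
X ⊆ Y = ∀ e → T (X e) → T (Y e)

Comparable : {E : Set a} → Subset E → Subset E → Set a
Comparable X Y = X ⊆ Y ⊎ Y ⊆ X

⊆-trans : {E : Set a} (X Y Z : Subset E) → X ⊆ Y → Y ⊆ Z → X ⊆ Z
⊆-trans X Y Z X⊆Y Y⊆Z e = Y⊆Z e ∘ X⊆Y e

T-injective : ∀ {x y} → (T x → T y) → (T y → T x) → x ≡ y
T-injective {false} {false} _ _ = refl
T-injective {false} {true}  _ g = ⊥-elim (g tt)
T-injective {true}  {false} f _ = ⊥-elim (f tt)
T-injective {true}  {true}  _ _ = refl

⊆-antisym : {E : Set a} → Extensionality a a →
            (X Y : Subset E) → X ⊆ Y → Y ⊆ X → X ≡ Y
⊆-antisym {a} ext X Y X⊆Y Y⊆X =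
  lower-extensionality 0ℓ a ext λ e → T-injective (X⊆Y e) (Y⊆X e)

module Comprehension (em : ExcludedMiddle a) {E : Set a} where

  ⟦_⟧ : (E → Set a) → Subset E
  ⟦ P ⟧ e = ⌊ em {P e} ⌋

  insert : E → Subset E → Subset E
  insert e X = ⟦ (λ e′ → T (X e′) ⊎ e′ ≡ e) ⟧

  ⋃ : Subset (Subset E) → Subset E
  ⋃ I = ⟦ (λ e → Σ[ X ∈ Subset E ] T (I X) × T (X e)) ⟧

  ⊆-insert : ∀ e X → X ⊆ insert e X
  ⊆-insert e X e′ = fromWitness ∘ inj₁

  ∈-insert : ∀ e X → T (insert e X e)
  ∈-insert e X = fromWitness (inj₂ refl)

  insert-⊆ : ∀ e X Y → X ⊆ Y → T (Y e) → insert e X ⊆ Y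
  insert-⊆ e X Y X⊆Y e∈Y e′ e′∈ with toWitness e′∈
  ... | inj₁ e′∈X = X⊆Y e′ e′∈X
  ... | inj₂ refl = e∈Y

  member-⊆-⋃ : ∀ I X → T (I X) → X ⊆ ⋃ I
  member-⊆-⋃ I X X∈I e e∈X = fromWitness (X , X∈I , e∈X)

  ⋃-⊆ : ∀ I Y → (∀ X → T (I X) → X ⊆ Y) → ⋃ I ⊆ Y
  ⋃-⊆ I Y h e e∈ with X , X∈I , e∈X ← toWitness e∈ = h X X∈I e e∈X

  IsChain : Subset (Subset E) → Set a
  IsChain I = ∀ X Y → T (I X) → T (I Y) → Comparable X Y

-- Maximal good subsets.

-- A choice-driven form of Zorn's lemma: starting from ⋃ ∅, keep inserting a
-- chosen admissible element and taking unions.  The subsets reached form a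
-- chain, and their union is maximal.
module Zorn
  (em : ExcludedMiddle a) (ext : Extensionality a a) {E : Set a}
  (Good : Subset E → Set a)
  (good-⋃ : ∀ I → (∀ X → T (I X) → Good X) → Comprehension.IsChain em I →
            Good (Comprehension.⋃ em I))
  where

  open Comprehension em {E}

  Candidate : Subset E → Set a
  Candidate X = Σ[ e ∈ E ] (¬ T (X e) × Good (insert e X))

  extend : ∀ X → Dec (Candidate X) → Subset E
  extend X (yes (e , _)) = insert e X
  extend X (no _)        = X

  step : Subset E → Subset E
  step X = extend X em

  ⊆-step : ∀ X → X ⊆ step X
  ⊆-step X with em {Candidate X}
  ... | yes (e , _) = ⊆-insert e X
  ... | no _        = λ _ e∈X → e∈X

  step-good : ∀ X → Good X → Good (step X)
  step-good X good with em {Candidate X}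
  ... | yes (_ , _ , good′) = good′
  ... | no _                = good

  -- `step` adds at most one element: `Y` contains it, and then all of `step X`, or stays within
  -- `X`.
  between-step : ∀ X Y → X ⊆ Y → Y ⊆ step X → step X ⊆ Y ⊎ Y ⊆ X
  between-step X Y X⊆Y Y⊆sX with em {Candidate X}
  ... | no _        = inj₂ Y⊆sX
  ... | yes (e , _) with em {Lift a (T (Y e))}
  ...   | yes (lift e∈Y) = inj₁ (insert-⊆ e X Y X⊆Y e∈Y)
  ...   | no e∉Y               = inj₂ λ e′ e′∈Y →
    [ (λ e′∈X → e′∈X) , (λ { refl → contradiction (lift e′∈Y) e∉Y }) ]′
      (toWitness (Y⊆sX e′ e′∈Y))

  step-comparable-⊆ : ∀ X Y → X ⊆ Y → Comparable (step X) Y →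
                      Comparable (step X) (step Y)
  step-comparable-⊆ X Y X⊆Y (inj₁ sX⊆Y) =
    inj₁ (⊆-trans (step X) Y (step Y) sX⊆Y (⊆-step Y))
  step-comparable-⊆ X Y X⊆Y (inj₂ Y⊆sX) with between-step X Y X⊆Y Y⊆sX
  ... | inj₁ sX⊆Y = inj₁ (⊆-trans (step X) Y (step Y) sX⊆Y (⊆-step Y))
  -- Antisymmetry makes `X` and `Y` equal, so `step` makes the same choice for both.
  ... | inj₂ Y⊆X with refl ← ⊆-antisym ext X Y X⊆Y Y⊆X = inj₁ λ _ e∈ → e∈

  step-comparable : ∀ X Y → Comparable X Y →
                    Comparable (step X) Y → Comparable X (step Y) →
                    Comparable (step X) (step Y)
  step-comparable X Y (inj₁ X⊆Y) sX~Y _ = step-comparable-⊆ X Y X⊆Y sX~Y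
  step-comparable X Y (inj₂ Y⊆X) _ X~sY =
    swap (step-comparable-⊆ Y X Y⊆X (swap X~sY))

  -- The empty family in `⋃-tower` gives the starting subset. Families are arbitrary here; that they
  -- are chains is proved afterwards.
  data Tower : Subset E → Set a where
    step-tower : ∀ X → Tower X → Tower (step X)
    ⋃-tower    : ∀ I → (∀ X → T (I X) → Tower X) → Tower (⋃ I)

  -- Either some member contains `Y`, or comparability puts every member inside `Y`.
  ⋃-comparable : ∀ I Y → (∀ X → T (I X) → Comparable X Y) → Comparable (⋃ I) Y
  ⋃-comparable I Y compare with em {Σ[ X ∈ Subset E ] (T (I X) × Y ⊆ X)}
  ... | yes (X , X∈I , Y⊆X) =
    inj₂ (⊆-trans Y X (⋃ I) Y⊆X (member-⊆-⋃ I X X∈I))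
  ... | no ∄X = inj₁ (⋃-⊆ I Y λ X X∈I →
    [ (λ X⊆Y → X⊆Y) , (λ Y⊆X → contradiction (X , X∈I , Y⊆X) ∄X) ]′ (compare X X∈I))

  -- Induction on both derivations: when both end in a step, each of the three comparisons used
  -- shortens at least one of them.
  tower-comparable : ∀ {X Y} → Tower X → Tower Y → Comparable X Y
  tower-comparable {Y = Y} (⋃-tower I tI) tY =
    ⋃-comparable I Y λ X X∈I → tower-comparable (tI X X∈I) tY
  tower-comparable {X = X} tX@(step-tower _ _) (⋃-tower J tJ) =
    swap (⋃-comparable J X λ Y Y∈J → swap (tower-comparable tX (tJ Y Y∈J)))
  tower-comparable tX@(step-tower X tX′) tY@(step-tower Y tY′) =
    step-comparable X Y
      (tower-comparable tX′ tY′) (tower-comparable tX tY′) (tower-comparable tX′ tY)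

  tower-good : ∀ {X} → Tower X → Good X
  tower-good (step-tower X tX) = step-good X (tower-good tX)
  tower-good (⋃-tower I tI)    = good-⋃ I (λ X X∈I → tower-good (tI X X∈I))
    λ X Y X∈I Y∈I → tower-comparable (tI X X∈I) (tI Y Y∈I)

  towers : Subset (Subset E)
  towers X = ⌊ em {Tower X} ⌋

  top : Subset E
  top = ⋃ towers

  top-tower : Tower top
  top-tower = ⋃-tower towers λ X → toWitness

  -- Towers are closed under unions and steps, so `step top` is one of the towers whose union is
  -- `top`.
  step-top-⊆ : step top ⊆ top
  step-top-⊆ =
    member-⊆-⋃ towers (step top) (fromWitness (step-tower top top-tower))

  no-candidate : ¬ Candidate top
  no-candidate with em {Candidate top} | step-top-⊆
  ... | yes (e , e∉top , _) | ⊆top = λ _ → e∉top (⊆top e (∈-insert e top))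
  ... | no ∄candidate       | _    = ∄candidate

  maximal : Σ[ M ∈ Subset E ] (Good M × (∀ e → Good (insert e M) → T (M e)))
  maximal = top , tower-good top-tower , λ e good →
    decidable-stable (T? (top e)) λ e∉top → no-candidate (e , e∉top , good)

-- Maximal acyclic subdigraphs.

module AcyclicSubdigraph
  (em : ExcludedMiddle a) (ext : Extensionality a a) {V : Set a}
  (R : Rel V a) (irrefl : Irreflexive _≡_ R)
  where

  open Comprehension em {V × V}

  Arc : Subset (V × V) → Rel V 0ℓ
  Arc X u v = T (X (u , v))

  Walk : Subset (V × V) → Rel V a
  Walk X = TransClosure (Arc X)

  walk-mono : ∀ X Y {u v} → X ⊆ Y → Walk X u v → Walk Y u v
  walk-mono X Y X⊆Y [ uv ]   = [ X⊆Y _ uv ]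
  walk-mono X Y X⊆Y (uw ∷ p) = X⊆Y _ uw ∷ walk-mono X Y X⊆Y p

  -- A walk has finitely many arcs, so in a chain the largest of the members supplying them contains
  -- them all.
  walk-in-member : ∀ I → IsChain I → ∀ {u v} → Walk (⋃ I) u v →
                   Σ[ X ∈ Subset (V × V) ] (T (I X) × Walk X u v)
  walk-in-member I chain [ uv ] with X , X∈I , uv∈X ← toWitness uv =
    X , X∈I , [ uv∈X ]
  walk-in-member I chain (uw ∷ p)
    with X , X∈I , uw∈X ← toWitness uw
       | Y , Y∈I , q    ← walk-in-member I chain p
    with chain X Y X∈I Y∈I
  ... | inj₁ X⊆Y = Y , Y∈I , X⊆Y _ uw∈X ∷ q
  ... | inj₂ Y⊆X = X , X∈I , uw∈X ∷ walk-mono Y X Y⊆X q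

  Good : Subset (V × V) → Set a
  Good X = (∀ u v → Arc X u v → R u v) × (∀ v → ¬ Walk X v v)

  good-⋃ : ∀ I → (∀ X → T (I X) → Good X) → IsChain I → Good (⋃ I)
  good-⋃ I good chain = arcs , acyclic
    where
    arcs : ∀ u v → Arc (⋃ I) u v → R u v
    arcs u v uv with X , X∈I , uv∈X ← toWitness uv =
      proj₁ (good X X∈I) u v uv∈X

    acyclic : ∀ v → ¬ Walk (⋃ I) v v
    acyclic v p with X , X∈I , q ← walk-in-member I chain p =
      proj₂ (good X X∈I) v q

  Walk₀ : Subset (V × V) → Rel V a
  Walk₀ X u v = u ≡ v ⊎ Walk X u v

  _++₀_ : ∀ {X u v w} → Walk₀ X u v → Walk₀ X v w → Walk₀ X u w
  inj₁ refl ++₀ q         = q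
  inj₂ p    ++₀ inj₁ refl = inj₂ p
  inj₂ p    ++₀ inj₂ q    = inj₂ (p ++ q)

  -- Keep the segment before the first use of the inserted arc and the one after the last; both lie
  -- in `X`, and either may be empty.
  walk-insert : ∀ X {u v x y} → Walk (insert (u , v) X) x y →
                Walk X x y ⊎ (Walk₀ X x u × Walk₀ X v y)
  walk-insert X [ xy ] with toWitness xy
  ... | inj₁ xy∈X = inj₁ [ xy∈X ]
  ... | inj₂ refl = inj₂ (inj₁ refl , inj₁ refl)
  walk-insert X (xw ∷ p) with toWitness xw | walk-insert X p
  ... | inj₁ xw∈X | inj₁ q              = inj₁ (xw∈X ∷ q)
  ... | inj₁ xw∈X | inj₂ (inj₁ refl , r) = inj₂ (inj₂ [ xw∈X ] , r)
  ... | inj₁ xw∈X | inj₂ (inj₂ q , r)    = inj₂ (inj₂ (xw∈X ∷ q) , r)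
  ... | inj₂ refl | inj₁ q              = inj₂ (inj₁ refl , inj₂ q)
  ... | inj₂ refl | inj₂ (_ , r)         = inj₂ (inj₁ refl , r)

  insert-good : ∀ X {u v} → Good X → R u v → ¬ Walk X v u →
                Good (insert (u , v) X)
  insert-good X {u} {v} (arcs , acyclic) uRv ¬vu = arcs′ , acyclic′
    where
    arcs′ : ∀ x y → Arc (insert (u , v) X) x y → R x y
    arcs′ x y xy with toWitness xy
    ... | inj₁ xy∈X = arcs x y xy∈X
    ... | inj₂ refl = uRv

    acyclic′ : ∀ x → ¬ Walk (insert (u , v) X) x x
    acyclic′ x p with walk-insert X p
    ... | inj₁ q = acyclic x q
    -- Joined at `x`, the segments lead from `v` to `u` in `X`: if empty, `R` would have a loop;
    -- otherwise `¬vu` excludes them.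
    ... | inj₂ (xu , vx) with _++₀_ {X} vx xu
    ...   | inj₁ v≡u = irrefl (sym v≡u) uRv
    ...   | inj₂ vu  = ¬vu vu

  -- If no walk of `M` leads back from `v` to `u`, inserting `(u , v)` closes no cycle, so
  -- maximality puts it in `M`.
  maximal-acyclic : Σ[ M ∈ Subset (V × V) ]
    (Good M × (∀ {u v} → R u v → Walk M u v ⊎ Walk M v u))
  maximal-acyclic with M , good , max ← Zorn.maximal em ext Good good-⋃ =
    M , good , λ {u} {v} uRv → joined M good max uRv em
    where
    joined : ∀ M → Good M → (∀ e → Good (insert e M) → T (M e)) →
             ∀ {u v} → R u v → Dec (Walk M v u) → Walk M u v ⊎ Walk M v u
    joined M good max uRv (yes vu) = inj₂ vu
    joined M good max uRv (no ¬vu) =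
      inj₁ [ max _ (insert-good M good uRv ¬vu) ]

-- Walks of prescribed length.

module WalkLength {V : Set a} (A : Rel V 0ℓ) where

  HasWalk : ℕ → Pred V a
  HasWalk zero    u = ⊤
  HasWalk (suc k) u = Σ[ v ∈ V ] (A u v × HasWalk k v)

  hasWalk-pred : ∀ k {u} → HasWalk (suc k) u → HasWalk k u
  hasWalk-pred zero    _            = _
  hasWalk-pred (suc k) (v , uv , p) = v , uv , hasWalk-pred k p

  -- The connecting walk may have several arcs; the surplus is trimmed from the far end to keep the
  -- length exactly `suc k`.
  hasWalk-prepend : ∀ {k u v} → TransClosure A u v →
                    HasWalk k v → HasWalk (suc k) u
  hasWalk-prepend         [ uv ]   h = _ , uv , h
  hasWalk-prepend {k = k} (uw ∷ p) h =
    _ , uw , hasWalk-pred k (hasWalk-prepend p h)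

  vertices : ∀ k {u} → HasWalk k u → Fin (suc k) → V
  vertices k       {u} _           zero    = u
  vertices (suc k)     (_ , _ , p) (suc i) = vertices k p i

  vertices-arc : ∀ k {u} (p : HasWalk k u) (i : Fin k) →
                 A (vertices k p (inject₁ i)) (vertices k p (suc i))
  vertices-arc (suc k)       (_ , uv , p) zero    = uv
  vertices-arc (suc k)       (_ , _  , p) (suc i) = vertices-arc k p i

  vertices-walk : ∀ k {u} (p : HasWalk k u) (i : Fin k) →
                  TransClosure A u (vertices k p (suc i))
  vertices-walk (suc k) (_ , uv , p) zero    = [ uv ]
  vertices-walk (suc k) (_ , uv , p) (suc i) = uv ∷ vertices-walk k p i

  -- After common initial arcs are stripped, a repeated vertex is the starting one, and the walk
  -- back to it is closed.
  vertices-injective : (∀ v → ¬ TransClosure A v v) →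
                       ∀ k {u} (p : HasWalk k u) {i j} →
                       vertices k p i ≡ vertices k p j → i ≡ j
  vertices-injective acyclic k p {zero} {zero} _ = refl
  vertices-injective acyclic (suc k) p {zero} {suc j} eq =
    contradiction (subst (TransClosure A _) (sym eq) (vertices-walk (suc k) p j)) (acyclic _)
  vertices-injective acyclic (suc k) p {suc i} {zero} eq =
    contradiction (subst (TransClosure A _) eq (vertices-walk (suc k) p i)) (acyclic _)
  vertices-injective acyclic (suc k) (_ , _ , p) {suc i} {suc j} eq =
    cong suc (vertices-injective acyclic k p eq)

  hasWalk⇒path : (∀ v → ¬ TransClosure A v v) → ∀ k {u} → HasWalk k u →
    Σ[ P ∈ DirectedPath V k ] (∀ i →
      A (source (DirectedPath.pathEdge P i)) (target (DirectedPath.pathEdge P i)))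
  hasWalk⇒path acyclic k p = record
    { vertex    = vertices k p
    ; injective = vertices-injective acyclic k p
    } , vertices-arc k p

-- The Gallai-Roy theorem.

last-before-failure : ∀ {p} {P : ℕ → Set p} → (∀ k → Dec (P k)) → P 0 →
                      ∀ n → ¬ P n → Σ[ k ∈ ℕ ] (k < n × P k × ¬ P (suc k))
last-before-failure P? P0 zero    ¬P = contradiction P0 ¬P
last-before-failure P? P0 (suc n) ¬P with P? n
... | yes Pn = n , n<1+n n , Pn , ¬P
... | no ¬Pn with k , k<n , Pk , ¬Psk ← last-before-failure P? P0 n ¬Pn =
  k , m<n⇒m<1+n k<n , Pk , ¬Psk

gallai-roy : ExcludedMiddle a → Extensionality a a → {V : Set a}
  (R : Rel V a) → Irreflexive _≡_ R → (ℓ : ℕ) →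
  ¬ (Σ[ P ∈ DirectedPath V ℓ ] (∀ i →
      R (source (DirectedPath.pathEdge P i)) (target (DirectedPath.pathEdge P i)))) →
  Σ[ colour ∈ (V → Fin ℓ) ] (∀ {u v} → R u v → colour u ≢ colour v)
gallai-roy em ext {V} R irrefl ℓ noPath
  with M , (arcs , acyclic) , joined ←
         AcyclicSubdigraph.maximal-acyclic em ext R irrefl =
  colour , proper
  where
  open WalkLength (λ u v → T (M (u , v)))

  height : ∀ v → Σ[ k ∈ ℕ ] (k < ℓ × HasWalk k v × ¬ HasWalk (suc k) v)
  -- Length `0` always succeeds; length `ℓ` fails, since a walk of `M` with `ℓ` arcs is a path in
  -- `R`.
  height v = last-before-failure {P = λ k → HasWalk k v} (λ k → em) _ ℓ λ h →
    let P , inM = hasWalk⇒path acyclic ℓ h in noPath (P , λ i → arcs _ _ (inM i))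

  colour : V → Fin ℓ
  colour v = fromℕ< (proj₁ (proj₂ (height v)))

  -- Were both heights `k`, the walk to `v` followed by one with `k` arcs would give a walk with
  -- `suc k` arcs from `u`.
  walk⇒≢ : ∀ {u v} → TransClosure (λ u v → T (M (u , v))) u v → colour u ≢ colour v
  walk⇒≢ {u} {v} p eq with height u | height v
  ... | k , k<ℓ , _ , ¬longer | k′ , k′<ℓ , walk , _
    with refl ← fromℕ<-injective k k′ k<ℓ k′<ℓ eq =
    ¬longer (hasWalk-prepend {k = k} p walk)

  proper : ∀ {u v} → R u v → colour u ≢ colour v
  proper uRv = [ walk⇒≢ , (λ p → walk⇒≢ p ∘ sym) ]′ (joined uRv)

-- Mixed-radix products of vertex colourings.

tuple : ∀ {r} (ℓ : Fin r → ℕ) → (∀ i → Fin (ℓ i)) → Fin (product (tabulate ℓ))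
tuple {zero}  ℓ f = zero
tuple {suc r} ℓ f = combine (f zero) (tuple (ℓ ∘ suc) (f ∘ suc))

tuple-injective : ∀ {r} (ℓ : Fin r → ℕ) (f g : ∀ i → Fin (ℓ i)) →
                  tuple ℓ f ≡ tuple ℓ g → ∀ i → f i ≡ g i
tuple-injective ℓ f g eq zero    = proj₁ (combine-injective (f zero) _ (g zero) _ eq)
tuple-injective ℓ f g eq (suc i) =
  tuple-injective (ℓ ∘ suc) (f ∘ suc) (g ∘ suc)
    (proj₂ (combine-injective (f zero) _ (g zero) _ eq)) i

-- Distinctness is stored in the relation to make it irreflexive.
ColourClass : {V : Set a} {r : ℕ} → Colouring V r → Fin (suc r) → Rel V a
ColourClass c k u v = Σ[ u≢v ∈ u ≢ v ] c (edge u v u≢v) ≡ k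

module _ {V : Set a} {r : ℕ} {ℓ : Fin r → ℕ} (c : Colouring V r)
  (colour : ∀ i → V → Fin (ℓ i))
  (proper : ∀ i {u v} → ColourClass c (inject₁ i) u v → colour i u ≢ colour i v)
  where

  part : V → Fin (product (tabulate ℓ))
  part v = tuple ℓ λ i → colour i v

  -- An edge of colour `inject₁ i` has its ends separated by `colour i`, whereas equal codes agree
  -- in every coordinate.
  part-monochromatic : ∀ e → part (source e) ≡ part (target e) → c e ≡ fromℕ r
  part-monochromatic (edge u v u≢v) eq = last (c (edge u v u≢v)) refl
    where
    last : ∀ k → c (edge u v u≢v) ≡ k → k ≡ fromℕ r
    last k ce≡k with view k
    ... | ‵fromℕ          = refl
    ... | ‵inj₁ {i = i} _ = contradiction
      (tuple-injective ℓ (λ i → colour i u) (λ i → colour i v) eq i)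
      -- The irrelevant proof `u≢v` can still be used to refute `u≡v`, since the goal there is
      -- absurdity.
      (proper i ((λ u≡v → ⊥-elim-irr (u≢v u≡v)) , ce≡k))

  product-partition : Σ[ U ∈ (Fin (product (tabulate ℓ)) → Pred V 0ℓ) ]
    (IsPartition U × (∀ j → MonochromaticOn c (fromℕ r) (U j)))
  product-partition =
    (λ j v → part v ≡ j) ,
    ((λ v → part v , refl) , λ i j i≢j (v∈i , v∈j) → i≢j (trans (sym v∈i) v∈j)) ,
    λ j e s∈j t∈j → part-monochromatic e (trans s∈j (sym t∈j))

theorem1p3 : ∀ {a : Level} → ExcludedMiddle a → Extensionality a a →
    (V : Set a) (r : ℕ) (ℓ : Fin r → ℕ) → (∀ i → 0 < ℓ i) →
    (c : Colouring V r) →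
    (∀ i → ¬ (∃[ P ] MonochromaticPath {length = ℓ i} c (inject₁ i) P)) →
    Σ[ U ∈ (Fin (product (tabulate ℓ)) → Pred V 0ℓ) ]
    (IsPartition U × (∀ j → MonochromaticOn c (fromℕ r) (U j)))
theorem1p3 em ext V r ℓ _ c noPath =
  product-partition c (proj₁ ∘ separate) (λ i → proj₂ (separate i))
  where
  separate : ∀ i → Σ[ colour ∈ (V → Fin (ℓ i)) ]
             (∀ {u v} → ColourClass c (inject₁ i) u v → colour u ≢ colour v)
  separate i = gallai-roy em ext (ColourClass c (inject₁ i))
    (λ u≡v (u≢v , _) → u≢v u≡v) (ℓ i)
    λ (P , inClass) → noPath i (P , proj₂ ∘ inClass)
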